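{- Let $\mathbb{F}$ be a field and let $P$ be a syntactic multilinear algebraic branching program (smABP) of size $S$ with source $s$ and sink $t$, computing a polynomial $f\in\mathbb{F}[x_1,\ldots,x_n]$. Then there exist sets of edges $\{(u_1,v_1),\ldots,(u_m,v_m)\}$ and $\{(w_1,a_1),\ldots,(w_r,a_r)\}$ of $P$ such that (1) for every $i\in\{1,\ldots,m\}$, $n/3\le |X_{s,u_i}|\le 2n/3$; (2) for every $i\in\{1,\ldots,r\}$, $|X_{s,w_i}|+|X_{a_i,t}|\le 2n/3$; and (3) $f=\sum_{i=1}^m [s,u_i]\cdot \mathrm{label}(u_i,v_i)\cdot[v_i,t]+\sum_{i=1}^r [s,w_i]\cdot\mathrm{label}(w_i,a_i)\cdot[a_i,t]$.
   Context: Let $X=\{x_1,\ldots,x_n\}$. An algebraic branching program (ABP) $P$ over $\mathbb{F}$ is a directed acyclic graph whose vertices are partitioned into layers $L_0,\ldots,L_\ell$, with edges going only from $L_i$ to $L_{i+1}$; $L_0=\{s\}$ ($s$ is the source, the one vertex of in-degree 0) and $L_\ell=\{t\}$ ($t$ is the sink, the one vertex of out-degree 0). Each edge $e$ carries a label $\mathrm{label}(e)\in X\cup\mathbb{F}$. The size of $P$ is its number of nodes. The weight of a path is the product of its edge labels, and the polynomial computed by $P$ is the sum of the weights of all $s$-to-$t$ paths. For nodes $u,v$, $[u,v]$ denotes the polynomial computed by the subprogram of $P$ with source $u$ and sink $v$ (the sum of weights of all $u$-to-$v$ paths; $[u,u]=1$), and $X_{u,v}$ denotes the set of all variables that occur as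 labels on some path from $u$ to $v$ in $P$. $P$ is syntactic multilinear (an smABP) if every variable occurs at most once on every $s$-to-$t$ path. Either of the two edge sets may be empty.
   Formalization: The program is assumed to have at least one layer of edges (ℓ ≥ 1, so s ≠ t); for the one-vertex program with s = t and no edges, f = 1 while every sum over edges is 0, so the claim fails there. -}

module Defs where

open import Algebra.Apartness.Bundles using (HeytingField)
open import Data.Bool.Base using (Bool; T; if_then_else_)
open import Data.Bool.Properties using (T?; T-irrelevant)
open import Data.Empty using (⊥-elim)
open import Data.Fin.Base using (Fin; zero; toℕ; fromℕ)
import Data.Fin.Properties as Fin
open import Data.Fin.Subset using (Subset; ⁅_⁆; ⋃)
open import Data.List.Base using (List; []; _∷_; _++_; map; concatMap; cartesianProductWith; foldr; filter; length; allFin)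
open import Data.List.Membership.Propositional using (_∈_)
open import Data.List.Membership.Propositional.Properties using (∈-map⁺; ∈-map⁻; ∈-++⁺ˡ; ∈-++⁺ʳ; ∈-++⁻; ∈-allFin)
open import Data.List.Relation.Unary.All using ([]; _∷_)
import Data.List.Relation.Unary.All.Properties as All
open import Data.List.Relation.Unary.AllPairs using ([]; _∷_)
open import Data.List.Relation.Unary.Any using (here; there)
open import Data.List.Relation.Unary.Unique.Propositional using (Unique)
import Data.List.Relation.Unary.Unique.Propositional.Properties as Unique
open import Data.Nat.Base as ℕ using (ℕ; zero; suc; _∸_; _<_; _≤_)
import Data.Nat.Properties as ℕ
open import Data.Product.Base using (_×_; _,_)
open import Data.Sum.Base using (inj₁; inj₂)
open import Data.Vec.Base using (Vec; replicate; zipWith; updateAt)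
open import Data.Vec.Properties using (≡-dec)
open import Function.Bundles using (_⇔_)
open import Level using (Level)
open import Relation.Binary.PropositionalEquality using (_≡_; refl; sym; trans; cong; subst)
open import Relation.Nullary using (¬_; Dec; yes; no; does)

module _ {c ℓ₁ ℓ₂ : Level} (F : HeytingField c ℓ₁ ℓ₂) (n : ℕ) where

  private module F = HeytingField F

  module Polynomials where

    infix  4 _≈ₚ_
    infixl 6 _+ₚ_
    infixl 7 _*ₚ_

    -- A monomial is its exponent vector.
    Monomial : Set
    Monomial = Vec ℕ n

    -- A polynomial is presented as a formal sum of terms; the same monomial
    -- may occur several times, so polynomials are compared by _≈ₚ_, not _≡_.
    Polynomial : Set c
    Polynomial = List (F.Carrier × Monomial)

    coeff : Polynomial → Monomial → F.Carrier
    coeff []            m = F.0#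
    coeff ((a , e) ∷ p) m =
      (if does (≡-dec ℕ._≟_ e m) then a else F.0#) F.+ coeff p m

    _≈ₚ_ : Polynomial → Polynomial → Set ℓ₁
    p ≈ₚ q = ∀ m → coeff p m F.≈ coeff q m

    constₚ : F.Carrier → Polynomial
    constₚ a = (a , replicate n 0) ∷ []

    varₚ : Fin n → Polynomial
    varₚ x = (F.1# , updateAt (replicate n 0) x suc) ∷ []

    0ₚ 1ₚ : Polynomial
    0ₚ = []
    1ₚ = constₚ F.1#

    _+ₚ_ _*ₚ_ : Polynomial → Polynomial → Polynomial
    _+ₚ_ = _++_
    _*ₚ_ = cartesianProductWith
      (λ (a , d) (b , e) → a F.* b , zipWith ℕ._+_ d e)

    sumₚ : List Polynomial → Polynomial
    sumₚ = foldr _+ₚ_ 0ₚ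

  open Polynomials

  data Label : Set c where
    var   : Fin n → Label
    const : F.Carrier → Label

  ⟦_⟧ : Label → Polynomial
  ⟦ var x ⟧   = varₚ x
  ⟦ const a ⟧ = constₚ a

  labelVars : Label → List (Fin n)
  labelVars (var x)   = x ∷ []
  labelVars (const _) = []

  -- The underlying digraph is simple, so an edge is a pair of vertices.
  -- The last layer index is positive: a one-vertex program (s = t) would
  -- compute 1 without having any edge.
  record ABP (S : ℕ) : Set c where
    field
      adjacent : Fin S → Fin S → Bool

    Adj : Fin S → Fin S → Set
    Adj u v = T (adjacent u v)

    field
      label      : ∀ u v → Adj u v → Label
      s t        : Fin S
      lastLayer  : ℕ
      layer      : Fin S → Fin (suc lastLayer)
      0<last     : 0 < lastLayer
      adj-layer  : ∀ u v → Adj u v → toℕ (layer v) ≡ suc (toℕ (layer u))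
      layer-s    : ∀ v → layer v ≡ zero ⇔ v ≡ s
      layer-t    : ∀ v → layer v ≡ fromℕ lastLayer ⇔ v ≡ t
      indegree0  : ∀ v → (∀ u → ¬ Adj u v) ⇔ v ≡ s
      outdegree0 : ∀ u → (∀ v → ¬ Adj u v) ⇔ u ≡ t

  module Program {S : ℕ} (P : ABP S) where

    open ABP P public

    record Edge : Set where
      constructor edge
      field
        tail head : Fin S
        isEdge    : Adj tail head

    open Edge public

    edgeLabel : Edge → Label
    edgeLabel (edge u v e) = label u v e

    infixr 5 _∷_

    data Path : Fin S → Fin S → Set where
      []  : ∀ {u} → Path u u
      _∷_ : ∀ {u w v} → Adj u w → Path w v → Path u v

    weight : ∀ {u v} → Path u v → Polynomial
    weight []                = 1ₚ
    weight (_∷_ {u} {w} e p) = ⟦ label u w e ⟧ *ₚ weight p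

    pathVars : ∀ {u v} → Path u v → List (Fin n)
    pathVars []                = []
    pathVars (_∷_ {u} {w} e p) = labelVars (label u w e) ++ pathVars p

    occurrences : ∀ {u v} → Fin n → Path u v → ℕ
    occurrences x p = length (filter (x Fin.≟_) (pathVars p))

    SyntacticMultilinear : Set
    SyntacticMultilinear = ∀ (p : Path s t) x → occurrences x p ≤ 1

    trivialPath : ∀ {u v} → Dec (u ≡ v) → List (Path u v)
    trivialPath (yes refl) = [] ∷ []
    trivialPath (no _)     = []

    extend : ∀ {u w v} → Dec (Adj u w) → List (Path w v) → List (Path u v)
    extend (yes e) ps = map (e ∷_) ps
    extend (no _)  ps = []

    pathsOfLength : ℕ → ∀ u v → List (Path u v)
    pathsOfLength zero    u v = trivialPath (u Fin.≟ v)
    pathsOfLength (suc k) u v =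
      concatMap (λ w → extend (T? (adjacent u w)) (pathsOfLength k w v)) (allFin S)

    -- Each edge raises the layer by one, so this list contains every path
    -- from u to v exactly once: see ∈-paths and paths-unique below.
    paths : ∀ u v → List (Path u v)
    paths u v = pathsOfLength (toℕ (layer v) ∸ toℕ (layer u)) u v

    [_,_] : Fin S → Fin S → Polynomial
    [ u , v ] = sumₚ (map weight (paths u v))

    X : Fin S → Fin S → Subset n
    X u v = ⋃ (map ⁅_⁆ (concatMap pathVars (paths u v)))

    Computes : Polynomial → Set ℓ₁
    Computes f = f ≈ₚ [ s , t ]

    -- [s,u] · label(u,v) · [v,t]
    through : Edge → Polynomial
    through e = [ s , tail e ] *ₚ ⟦ edgeLabel e ⟧ *ₚ [ head e , t ]

    ∑through : List Edge → Polynomial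
    ∑through es = sumₚ (map through es)

    module Enumeration where

      pathLength : ∀ {u v} → Path u v → ℕ
      pathLength []      = 0
      pathLength (_ ∷ p) = suc (pathLength p)

      layer-path : ∀ {u v} (p : Path u v) →
                   toℕ (layer v) ≡ pathLength p ℕ.+ toℕ (layer u)
      layer-path []                = refl
      layer-path (_∷_ {u} {w} e p) =
        trans (layer-path p)
          (trans (cong (pathLength p ℕ.+_) (adj-layer u w e)) (ℕ.+-suc _ _))

      ∈-concatMap : ∀ {A : Set} (f : Fin S → List A) {x w ws} →
                    w ∈ ws → x ∈ f w → x ∈ concatMap f ws
      ∈-concatMap f             (here refl) x∈ = ∈-++⁺ˡ x∈
      ∈-concatMap f {ws = w ∷ _} (there w∈) x∈ = ∈-++⁺ʳ (f w) (∈-concatMap f w∈ x∈)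

      ∈-extend : ∀ {u w v} (d : Dec (Adj u w)) (e : Adj u w) {p : Path w v} {ps} →
                 p ∈ ps → (e ∷ p) ∈ extend d ps
      ∈-extend (no ¬e)  e p∈ = ⊥-elim (¬e e)
      ∈-extend (yes e′) e {p} {ps} p∈ =
        subst (λ e′ → (e ∷ p) ∈ map (e′ ∷_) ps) (T-irrelevant e e′) (∈-map⁺ (e ∷_) p∈)

      ∈-trivialPath : ∀ {u} (d : Dec (u ≡ u)) → [] ∈ trivialPath d
      ∈-trivialPath (yes refl) = here refl
      ∈-trivialPath (no u≢u)   = ⊥-elim (u≢u refl)

      ∈-pathsOfLength : ∀ {u v} (p : Path u v) → p ∈ pathsOfLength (pathLength p) u v
      ∈-pathsOfLength {u} []                = ∈-trivialPath (u Fin.≟ u)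
      ∈-pathsOfLength {u} {v} (_∷_ {w = w} e p) =
        ∈-concatMap (λ w → extend (T? (adjacent u w)) (pathsOfLength (pathLength p) w v))
          (∈-allFin w) (∈-extend (T? (adjacent u w)) e (∈-pathsOfLength p))

      data StartsWith {u v} (w : Fin S) : Path u v → Set where
        starts : (e : Adj u w) (p : Path w v) → StartsWith w (e ∷ p)

      startsWith-functional : ∀ {u v w w′} {p : Path u v} →
                              StartsWith w p → StartsWith w′ p → w ≡ w′
      startsWith-functional (starts _ _) (starts _ _) = refl

      extend-starts : ∀ {u w v} (d : Dec (Adj u w)) (ps : List (Path w v)) {q} →
                      q ∈ extend d ps → StartsWith w q
      extend-starts (yes e) ps q∈ with ∈-map⁻ (e ∷_) q∈
      ... | p , _ , refl = starts e p

      extend-unique : ∀ {u w v} (d : Dec (Adj u w)) {ps : List (Path w v)} →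
                      Unique ps → Unique (extend d ps)
      extend-unique (yes e) ps! = Unique.map⁺ (λ { refl → refl }) ps!
      extend-unique (no _)  ps! = []

      trivialPath-unique : ∀ {u v} (d : Dec (u ≡ v)) → Unique (trivialPath d)
      trivialPath-unique (yes refl) = [] ∷ []
      trivialPath-unique (no _)     = []

      concatMap-starts : ∀ {u v} (f : Fin S → List (Path u v)) →
        (∀ w {q} → q ∈ f w → StartsWith w q) →
        ∀ ws {q w} → q ∈ concatMap f ws → StartsWith w q → w ∈ ws
      concatMap-starts f st (w′ ∷ ws) q∈ sq with ∈-++⁻ (f w′) q∈
      ... | inj₁ q∈f = here (startsWith-functional sq (st w′ q∈f))
      ... | inj₂ q∈r = there (concatMap-starts f st ws q∈r sq)

      concatMap-unique : ∀ {u v} (f : Fin S → List (Path u v)) →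
        (∀ w {q} → q ∈ f w → StartsWith w q) → (∀ w → Unique (f w)) →
        ∀ {ws} → Unique ws → Unique (concatMap f ws)
      concatMap-unique f st f! [] = []
      concatMap-unique f st f! {w ∷ ws} (w∉ ∷ ws!) =
        Unique.++⁺ (f! w) (concatMap-unique f st f! ws!)
          (λ (q∈f , q∈r) →
            All.All¬⇒¬Any w∉ (concatMap-starts f st ws q∈r (st w q∈f)))

      pathsOfLength-unique : ∀ k u v → Unique (pathsOfLength k u v)
      pathsOfLength-unique zero    u v = trivialPath-unique (u Fin.≟ v)
      pathsOfLength-unique (suc k) u v = concatMap-unique _
        (λ w → extend-starts (T? (adjacent u w)) (pathsOfLength k w v))
        (λ w → extend-unique (T? (adjacent u w)) (pathsOfLength-unique k w v))
        (Unique.allFin⁺ S)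

    open Enumeration

    ∈-paths : ∀ {u v} (p : Path u v) → p ∈ paths u v
    ∈-paths {u} {v} p = subst (λ k → p ∈ pathsOfLength k u v)
      (sym (trans (cong (_∸ toℕ (layer u)) (layer-path p))
                  (ℕ.m+n∸n≡m (pathLength p) (toℕ (layer u)))))
      (∈-pathsOfLength p)

    paths-unique : ∀ u v → Unique (paths u v)
    paths-unique u v = pathsOfLength-unique (toℕ (layer v) ∸ toℕ (layer u)) u v

{-# OPTIONS --safe #-}
module Submission where

-- Call a vertex u low if u ≠ t and |X_{s,u}| ≤ 2n/3.  Since X_{s,u} grows along
-- paths, the low vertices form an initial segment of every s-t path, so each s-t
-- path uses exactly one edge (u,v) from a low to a non-low vertex, and f is the sum
-- of [s,u] · label(u,v) · [v,t] over these cut edges.  If |X_{s,u}| ≥ n/3, the edge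
-- is of the first kind.  Otherwise it is of the second kind: either v = t and
-- X_{t,t} = ∅, or |X_{s,v}| > 2n/3, and then |X_{v,t}| < n/3 because multilinearity
-- makes X_{s,v} and X_{v,t} disjoint.

open import Defs
open import Algebra.Apartness.Bundles using (HeytingField)
open import Data.Bool.Base using (true; false)
open import Data.Bool.Properties using (T?; T-irrelevant)
open import Data.Fin.Base using (Fin; toℕ)
import Data.Fin.Properties as Fin
open import Data.Fin.Subset using (Subset; ∣_∣; ⁅_⁆; ⋃; ∁; Empty) renaming (_∈_ to _∈ˢ_)
import Data.Fin.Subset.Properties as Subset
open import Data.List.Base using (List; []; _∷_; _++_; map; concatMap; cartesianProduct; cartesianProductWith; filter; length; allFin)
open import Data.List.Membership.Propositional using (_∈_; find; lose)
import Data.List.Membership.Propositional.Properties as ∈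
open import Data.List.Membership.Propositional.Properties.WithK using (unique∧set⇒bag)
import Data.List.Properties as List
open import Data.List.Relation.Binary.BagAndSetEquality using (∼bag⇒↭)
open import Data.List.Relation.Binary.Permutation.Propositional using (_↭_; refl; prep; swap; trans)
open import Data.List.Relation.Binary.Permutation.Propositional.Properties using (map⁺)
open import Data.List.Relation.Binary.Pointwise as Pointwise using (Pointwise; []; _∷_)
open import Data.List.Relation.Unary.All as All using (All; []; _∷_)
import Data.List.Relation.Unary.All.Properties as All
open import Data.List.Relation.Unary.AllPairs using ([]; _∷_)
open import Data.List.Relation.Unary.Any using (here; there)
open import Data.List.Relation.Unary.Unique.Propositional using (Unique)
import Data.List.Relation.Unary.Unique.Propositional.Properties as Unique
open import Data.Nat.Base using (ℕ; suc; _+_; _*_; _∸_; _≤_; z≤n; s≤s)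
import Data.Nat.Properties as ℕ
open import Data.Product using (_×_; _,_; proj₁; proj₂; Σ-syntax; ∃; ∃₂)
open import Data.Sum using (inj₁; inj₂)
open import Data.Vec.Base using (replicate; updateAt; zipWith)
import Data.Vec.Properties as Vec
open import Function.Base using (_∘_; _$_)
open import Function.Bundles using (mk⇔; module Equivalence)
open import Relation.Binary.PropositionalEquality as ≡ using (_≡_; _≢_; refl; sym; cong; cong₂; subst)
open import Relation.Nullary using (¬_; Dec; yes; no; does; contradiction; _×-dec_; ¬?)
open import Relation.Unary using (Decidable)

-- Duplicate-free lists and finite subsets.

Unique-concatMap⁺ : ∀ {a b} {A : Set a} {B : Set b} (f : A → List B) {xs} →
  Unique xs → All (Unique ∘ f) xs →
  (∀ {x y z} → x ∈ xs → y ∈ xs → z ∈ f x → z ∈ f y → x ≡ y) →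
  Unique (concatMap f xs)
Unique-concatMap⁺ f [] [] inj = []
Unique-concatMap⁺ f {x ∷ xs} (x∉ ∷ xs!) (fx! ∷ fxs!) inj =
  Unique.++⁺ fx!
    (Unique-concatMap⁺ f xs! fxs! (λ x∈ y∈ → inj (there x∈) (there y∈)))
    λ (z∈fx , z∈r) → let y , y∈xs , z∈fy = find (∈.∈-concatMap⁻ f z∈r) in
      All.lookup x∉ y∈xs (inj (here refl) (there y∈xs) z∈fx z∈fy)

∈-⋃-singletons⁺ : ∀ {n} {x : Fin n} {xs} → x ∈ xs → x ∈ˢ ⋃ (map ⁅_⁆ xs)
∈-⋃-singletons⁺ (here refl) = Subset.x∈p∪q⁺ (inj₁ (Subset.x∈⁅x⁆ _))
∈-⋃-singletons⁺ (there x∈)  = Subset.x∈p∪q⁺ (inj₂ (∈-⋃-singletons⁺ x∈))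

∈-⋃-singletons⁻ : ∀ {n} {x : Fin n} xs → x ∈ˢ ⋃ (map ⁅_⁆ xs) → x ∈ xs
∈-⋃-singletons⁻ []       x∈ = contradiction x∈ Subset.∉⊥
∈-⋃-singletons⁻ (y ∷ xs) x∈ with Subset.x∈p∪q⁻ ⁅ y ⁆ _ x∈
... | inj₁ x∈y  = here (Subset.x∈⁅y⁆⇒x≡y y x∈y)
... | inj₂ x∈xs = there (∈-⋃-singletons⁻ xs x∈xs)

disjoint⇒∣p∣+∣q∣≤n : ∀ {n} (p q : Subset n) →
  (∀ {x} → x ∈ˢ p → ¬ x ∈ˢ q) → ∣ p ∣ + ∣ q ∣ ≤ n
disjoint⇒∣p∣+∣q∣≤n {n} p q p∩q=∅ = begin
  ∣ p ∣ + ∣ q ∣       ≤⟨ ℕ.+-monoʳ-≤ ∣ p ∣ (Subset.p⊆q⇒∣p∣≤∣q∣ λ x∈q → Subset.x∉p⇒x∈∁p (λ x∈p → p∩q=∅ x∈p x∈q)) ⟩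
  ∣ p ∣ + ∣ ∁ p ∣     ≡⟨ cong (∣ p ∣ +_) (Subset.∣∁p∣≡n∸∣p∣ p) ⟩
  ∣ p ∣ + (n ∸ ∣ p ∣) ≡⟨ ℕ.m+[n∸m]≡n (Subset.∣p∣≤n p) ⟩
  n                   ∎
  where open ℕ.≤-Reasoning

-- Equality of polynomials presented as lists of terms.

module PolynomialEquality {c ℓ₁ ℓ₂} (F : HeytingField c ℓ₁ ℓ₂) (n : ℕ) where

  open Polynomials F n
  private module F = HeytingField F

  Term : Set c
  Term = F.Carrier × Monomial

  infixl 7 _·_
  infix  4 _≈ₜ_

  _·_ : Term → Term → Term
  (a , d) · (b , e) = a F.* b , zipWith _+_ d e

  1ₜ : Term
  1ₜ = F.1# , replicate n 0

  -- Exponent vectors are compared propositionally, so equivalent terms always contribute to the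
  -- same coefficient; only the scalars need the field's equality.
  _≈ₜ_ : Term → Term → Set ℓ₁
  (a , d) ≈ₜ (b , e) = a F.≈ b × d ≡ e

  ≈ₜ-refl : ∀ {x} → x ≈ₜ x
  ≈ₜ-refl = F.refl , refl

  ≈ₜ-sym : ∀ {x y} → x ≈ₜ y → y ≈ₜ x
  ≈ₜ-sym (p , q) = F.sym p , sym q

  ≈ₜ-trans : ∀ {x y z} → x ≈ₜ y → y ≈ₜ z → x ≈ₜ z
  ≈ₜ-trans (p , q) (p′ , q′) = F.trans p p′ , ≡.trans q q′

  ·-cong : ∀ {x x′ y y′} → x ≈ₜ x′ → y ≈ₜ y′ → x · y ≈ₜ x′ · y′
  ·-cong (p , q) (p′ , q′) = F.*-cong p p′ , cong₂ (zipWith _+_) q q′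

  ·-assoc : ∀ x y z → (x · y) · z ≈ₜ x · (y · z)
  ·-assoc (a , d) (b , e) (c , f) = F.*-assoc a b c , Vec.zipWith-assoc ℕ.+-assoc d e f

  ·-identityˡ : ∀ x → 1ₜ · x ≈ₜ x
  ·-identityˡ (a , d) = F.*-identityˡ a , Vec.zipWith-identityˡ ℕ.+-identityˡ d

  Pointwise⇒≈ₚ : ∀ {p q} → Pointwise _≈ₜ_ p q → p ≈ₚ q
  Pointwise⇒≈ₚ []                                 m = F.refl
  Pointwise⇒≈ₚ (_∷_ {x = _ , e} (a≈b , refl) p≈q) m
    with does (Vec.≡-dec ℕ._≟_ e m)
  ... | true  = F.+-cong a≈b (Pointwise⇒≈ₚ p≈q m)
  ... | false = F.+-cong F.refl (Pointwise⇒≈ₚ p≈q m)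

  -- Together with `Pointwise⇒≈ₚ` this reduces an identity of polynomials to a permutation of their
  -- terms followed by termwise rewriting.
  ↭⇒≈ₚ : ∀ {p q} → p ↭ q → p ≈ₚ q
  ↭⇒≈ₚ refl           m = F.refl
  ↭⇒≈ₚ (prep x r)     m = F.+-cong F.refl (↭⇒≈ₚ r m)
  ↭⇒≈ₚ (swap x y r)   m = F.trans (F.sym (F.+-assoc _ _ _))
    (F.trans (F.+-cong (F.+-comm _ _) (↭⇒≈ₚ r m)) (F.+-assoc _ _ _))
  ↭⇒≈ₚ (trans r r′)   m = F.trans (↭⇒≈ₚ r m) (↭⇒≈ₚ r′ m)

module _ {c ℓ₁ ℓ₂} (F : HeytingField c ℓ₁ ℓ₂) (n : ℕ) {S : ℕ} (P : ABP F n S) where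

  open Polynomials F n
  open PolynomialEquality F n
  open Program F n P
  open Enumeration
  private module F = HeytingField F

  -- Duplicate-free enumeration of the edges.

  edgesBetween : ∀ {u v} → Dec (Adj u v) → List Edge
  edgesBetween (yes e) = edge _ _ e ∷ []
  edgesBetween (no _)  = []

  edgesAt : Fin S × Fin S → List Edge
  edgesAt (u , v) = edgesBetween (T? (adjacent u v))

  allEdges : List Edge
  allEdges = concatMap edgesAt (cartesianProduct (allFin S) (allFin S))

  ∈-edgesBetween⁺ : ∀ {u v} (d : Dec (Adj u v)) e → edge u v e ∈ edgesBetween d
  ∈-edgesBetween⁺ (yes e′) e = here (cong (edge _ _) (T-irrelevant e e′))
  ∈-edgesBetween⁺ (no ¬e)  e = contradiction e ¬e

  ∈-edgesBetween⁻ : ∀ {u v} (d : Dec (Adj u v)) {e} →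
                    e ∈ edgesBetween d → (u , v) ≡ (tail e , head e)
  ∈-edgesBetween⁻ (yes _) (here refl) = refl

  edgesBetween-unique : ∀ {u v} (d : Dec (Adj u v)) → Unique (edgesBetween d)
  edgesBetween-unique (yes _) = [] ∷ []
  edgesBetween-unique (no _)  = []

  ∈-allEdges : ∀ e → e ∈ allEdges
  ∈-allEdges (edge u v e) = ∈.∈-concatMap⁺ edgesAt
    (lose (∈.∈-cartesianProduct⁺ (∈.∈-allFin u) (∈.∈-allFin v)) (∈-edgesBetween⁺ _ e))

  allEdges-unique : Unique allEdges
  allEdges-unique = Unique-concatMap⁺ edgesAt
    (Unique.cartesianProduct⁺ (Unique.allFin⁺ S) (Unique.allFin⁺ S))
    (All.universal (λ _ → edgesBetween-unique _) _)
    λ _ _ e∈ e∈′ → ≡.trans (∈-edgesBetween⁻ _ e∈) (sym (∈-edgesBetween⁻ _ e∈′))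

  -- Concatenation of paths and its cancellation.

  infixr 5 _◅◅_

  _◅◅_ : ∀ {u w v} → Path u w → Path w v → Path u v
  []      ◅◅ q = q
  (e ∷ p) ◅◅ q = e ∷ (p ◅◅ q)

  -- Each edge raises the layer by one, so a path's length is the difference of the layers of its
  -- ends.
  closedPath-length : ∀ {u} (p : Path u u) → pathLength p ≡ 0
  closedPath-length {u} p =
    ℕ.+-cancelʳ-≡ (toℕ (layer u)) (pathLength p) 0 (sym (layer-path p))

  -- Matching on `refl` succeeds here because both tails are variables; applied to concatenations it
  -- would get stuck. The result therefore passes the components on as separate equations.
  ∷-injective : ∀ {u w w′ v} {e : Adj u w} {e′ : Adj u w′} {p : Path w v} {p′ : Path w′ v} →
    _≡_ {A = Path u v} (e ∷ p) (e′ ∷ p′) →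
    Σ[ w≡w′ ∈ w ≡ w′ ] subst (Adj u) w≡w′ e ≡ e′ × subst (λ w → Path w v) w≡w′ p ≡ p′
  ∷-injective refl = refl , refl , refl

  -- Both prefixes end at the tail of the same edge. If just one of them were empty, the other would
  -- be a nonempty closed path.
  ◅◅∷-injective : ∀ {u a b v} {e : Adj a b} (p p′ : Path u a) {q q′ : Path b v} →
    p ◅◅ e ∷ q ≡ p′ ◅◅ e ∷ q′ → p ≡ p′ × q ≡ q′
  ◅◅∷-injective []      []        refl = refl , refl
  ◅◅∷-injective []      (e′ ∷ p′) eq   = contradiction (closedPath-length (e′ ∷ p′)) λ ()
  ◅◅∷-injective (e ∷ p) []        eq   = contradiction (closedPath-length (e ∷ p)) λ ()
  ◅◅∷-injective (e ∷ p) (e′ ∷ p′) eq with ∷-injective eq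
  ... | refl , refl , eq′ with ◅◅∷-injective p p′ eq′
  ...   | refl , refl = refl , refl

  -- Path weights as single terms.

  labelTerm : Label F n → Term
  labelTerm (var x)   = F.1# , updateAt (replicate n 0) x suc
  labelTerm (const a) = a , replicate n 0

  ⟦⟧≡[labelTerm] : ∀ l → ⟦_⟧ F n l ≡ labelTerm l ∷ []
  ⟦⟧≡[labelTerm] (var x)   = refl
  ⟦⟧≡[labelTerm] (const a) = refl

  term : ∀ {u v} → Path u v → Term
  term []                = 1ₜ
  term (_∷_ {u} {w} e p) = labelTerm (label u w e) · term p

  weight≡[term] : ∀ {u v} (p : Path u v) → weight p ≡ term p ∷ []
  weight≡[term] []                = refl
  weight≡[term] (_∷_ {u} {w} e p) =
    cong₂ _*ₚ_ (⟦⟧≡[labelTerm] (label u w e)) (weight≡[term] p)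

  -- Every label, hence every weight, is a one-term polynomial, and the sum is list concatenation;
  -- so the equality is propositional, with one term per path.
  [,]≡terms : ∀ u v → [ u , v ] ≡ map term (paths u v)
  [,]≡terms u v = ≡.trans (List.concatMap-cong weight≡[term] (paths u v))
    (≡.trans (sym (List.concatMap-map (_∷ []) term (paths u v)))
             (List.concatMap-pure (map term (paths u v))))

  -- The right-hand side is bracketed as the product in `through`.
  term-◅◅∷ : ∀ {u a b v} (p : Path u a) (e : Adj a b) (q : Path b v) →
             term (p ◅◅ e ∷ q) ≈ₜ (term p · labelTerm (label a b e)) · term q
  term-◅◅∷ [] e q = ≈ₜ-sym (·-cong (·-identityˡ _) ≈ₜ-refl)
  term-◅◅∷ (x ∷ p) e q = ≈ₜ-trans (·-cong ≈ₜ-refl (term-◅◅∷ p e q))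
    (≈ₜ-trans (≈ₜ-sym (·-assoc _ _ _))
              (·-cong (≈ₜ-sym (·-assoc _ _ _)) ≈ₜ-refl))

  -- Source-to-sink paths through a given edge.

  pathsThrough : Edge → List (Path s t)
  pathsThrough (edge u v e) =
    cartesianProductWith (λ p q → p ◅◅ e ∷ q) (paths s u) (paths v t)

  pathsThrough-unique : ∀ e → Unique (pathsThrough e)
  pathsThrough-unique (edge u v e) =
    Unique.cartesianProductWith⁺ _ (◅◅∷-injective _ _) (paths-unique s u) (paths-unique v t)

  ∈-pathsThrough⁺ : ∀ {u v} (p : Path s u) (e : Adj u v) (q : Path v t) →
                    p ◅◅ e ∷ q ∈ pathsThrough (edge u v e)
  ∈-pathsThrough⁺ p e q = ∈.∈-cartesianProductWith⁺ _ (∈-paths p) (∈-paths q)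

  ∈-pathsThrough⁻ : ∀ {r} e → r ∈ pathsThrough e →
                    ∃₂ λ p q → r ≡ p ◅◅ isEdge e ∷ q
  ∈-pathsThrough⁻ (edge u v e) r∈
    with p , q , _ , _ , eq ← ∈.∈-cartesianProductWith⁻ _ (paths s u) (paths v t) r∈
    = p , q , eq

  -- Both `pathsThrough` and `_*ₚ_` enumerate pairs by `cartesianProductWith` in the same order, so
  -- the terms match position by position and no permutation is involved.
  terms-through : ∀ e → Pointwise _≈ₜ_ (map term (pathsThrough e)) (through e)
  terms-through (edge u v e)
    rewrite [,]≡terms s u | [,]≡terms v t | ⟦⟧≡[labelTerm] (label u v e) = go (paths s u)
    where
    ℓ  = labelTerm (label u v e)
    qs = paths v t

    row : ∀ p qs → Pointwise _≈ₜ_ (map term (map (λ q → p ◅◅ e ∷ q) qs))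
                                  (map ((term p · ℓ) ·_) (map term qs))
    row p []       = []
    row p (q ∷ qs) = term-◅◅∷ p e q ∷ row p qs

    go : ∀ ps → Pointwise _≈ₜ_
           (map term (cartesianProductWith (λ p q → p ◅◅ e ∷ q) ps qs))
           ((map term ps *ₚ (ℓ ∷ [])) *ₚ map term qs)
    go []       = []
    go (p ∷ ps) rewrite List.map-++ term (map (λ q → p ◅◅ e ∷ q) qs)
                          (cartesianProductWith (λ p q → p ◅◅ e ∷ q) ps qs) =
      Pointwise.++⁺ (row p qs) (go ps)

  terms-∑through : ∀ es →
    Pointwise _≈ₜ_ (map term (concatMap pathsThrough es)) (∑through es)
  terms-∑through []       = []
  terms-∑through (e ∷ es)
    rewrite List.map-++ term (pathsThrough e) (concatMap pathsThrough es) =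
    Pointwise.++⁺ (terms-through e) (terms-∑through es)

  -- Cuts defined by a set of vertices closed under predecessors.

  module Cut (Low : Fin S → Set) (low? : Decidable Low)
             (low-down : ∀ {u v} → Path u v → Low v → Low u)
             (low-s : Low s) (¬low-t : ¬ Low t) where

    Crossing : Edge → Set
    Crossing e = Low (tail e) × ¬ Low (head e)

    crossing? : Decidable Crossing
    crossing? e = low? (tail e) ×-dec ¬? (low? (head e))

    -- The edge found is the first one whose head is not low. The start is an arbitrary low vertex
    -- so that the induction can move along the path.
    crossing-exists : ∀ {u} → Low u → (r : Path u t) →
      ∃ λ e → Crossing e × ∃₂ λ (p : Path u (tail e)) q → r ≡ p ◅◅ isEdge e ∷ q
    crossing-exists low-u [] = contradiction low-u ¬low-t
    crossing-exists low-u (_∷_ {w = w} x r) with low? w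
    ... | no ¬low-w = edge _ _ x , (low-u , ¬low-w) , [] , r , refl
    ... | yes low-w with e , cr , p , q , eq ← crossing-exists low-w r
                    = e , cr , x ∷ p , q , cong (x ∷_) eq

    -- If the two edges sat at different positions, the low tail of the later one would be reachable
    -- from the non-low head of the earlier one, against `low-down`.
    crossing-unique : ∀ {u v} e e′ → Crossing e → Crossing e′ →
      (p : Path u (tail e)) (p′ : Path u (tail e′)) {q : Path (head e) v} {q′ : Path (head e′) v} →
      p ◅◅ isEdge e ∷ q ≡ p′ ◅◅ isEdge e′ ∷ q′ → e ≡ e′
    crossing-unique (edge _ _ _) (edge _ _ _) c c′ [] [] refl = refl
    crossing-unique (edge _ _ _) (edge _ _ _) c c′ [] (_ ∷ p′) refl =
      contradiction (low-down p′ (proj₁ c′)) (proj₂ c)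
    crossing-unique (edge _ _ _) (edge _ _ _) c c′ (_ ∷ p) [] refl =
      contradiction (low-down p (proj₁ c)) (proj₂ c′)
    crossing-unique e e′ c c′ (_ ∷ p) (_ ∷ p′) eq with ∷-injective eq
    ... | refl , _ , eq′ = crossing-unique e e′ c c′ p p′ eq′

    -- Two duplicate-free lists with the same members are permutations of each other. Existence of a
    -- crossing edge gives coverage; its uniqueness keeps the lists for different edges disjoint.
    paths↭pathsThrough : ∀ {es} → Unique es →
      (∀ {e} → e ∈ es → Crossing e) → (∀ {e} → Crossing e → e ∈ es) →
      paths s t ↭ concatMap pathsThrough es
    paths↭pathsThrough {es} es! sound complete = ∼bag⇒↭ $
      unique∧set⇒bag (paths-unique s t)
        (Unique-concatMap⁺ pathsThrough es! (All.universal pathsThrough-unique es) disjoint)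
        (mk⇔ (λ _ → covers _) (λ _ → ∈-paths _))
      where
      disjoint : ∀ {e e′ r} → e ∈ es → e′ ∈ es →
                 r ∈ pathsThrough e → r ∈ pathsThrough e′ → e ≡ e′
      disjoint {e} {e′} e∈ e′∈ r∈ r∈′
        with p , _ , eq ← ∈-pathsThrough⁻ e r∈ | p′ , _ , eq′ ← ∈-pathsThrough⁻ e′ r∈′
        = crossing-unique e e′ (sound e∈) (sound e′∈) p p′ (≡.trans (sym eq) eq′)

      covers : ∀ r → r ∈ concatMap pathsThrough es
      covers r with e , cr , p , q , refl ← crossing-exists low-s r =
        ∈.∈-concatMap⁺ pathsThrough (lose (complete cr) (∈-pathsThrough⁺ p (isEdge e) q))

    [s,t]≈∑through : ∀ {es} → Unique es →
      (∀ {e} → e ∈ es → Crossing e) → (∀ {e} → Crossing e → e ∈ es) →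
      [ s , t ] ≈ₚ ∑through es
    [s,t]≈∑through {es} es! sound complete m rewrite [,]≡terms s t = F.trans
      (↭⇒≈ₚ (map⁺ term (paths↭pathsThrough es! sound complete)) m)
      (Pointwise⇒≈ₚ (terms-∑through es) m)

  -- Variable sets and multilinearity.

  pathVars-◅◅ : ∀ {u w v} (p : Path u w) (q : Path w v) →
                pathVars (p ◅◅ q) ≡ pathVars p ++ pathVars q
  pathVars-◅◅ []                q = refl
  pathVars-◅◅ (_∷_ {u} {w} e p) q = ≡.trans
    (cong (labelVars F n (label u w e) ++_) (pathVars-◅◅ p q))
    (sym (List.++-assoc (labelVars F n (label u w e)) (pathVars p) (pathVars q)))

  occurrences-◅◅ : ∀ {u w v} x (p : Path u w) (q : Path w v) →
                   occurrences x (p ◅◅ q) ≡ occurrences x p + occurrences x q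
  occurrences-◅◅ x p q = ≡.trans
    (cong length (≡.trans (cong (filter (x Fin.≟_)) (pathVars-◅◅ p q))
                          (List.filter-++ (x Fin.≟_) (pathVars p) (pathVars q))))
    (List.length-++ (filter (x Fin.≟_) (pathVars p)))

  ∈-pathVars⇒occurs : ∀ {u v x} (p : Path u v) → x ∈ pathVars p → 1 ≤ occurrences x p
  ∈-pathVars⇒occurs {x = x} p x∈ = ∈.∈-length (∈.∈-filter⁺ (x Fin.≟_) x∈ refl)

  ∈-X⁺ : ∀ {u v x} (p : Path u v) → x ∈ pathVars p → x ∈ˢ X u v
  ∈-X⁺ p x∈ = ∈-⋃-singletons⁺ (∈.∈-concatMap⁺ pathVars (lose (∈-paths p) x∈))

  ∈-X⁻ : ∀ {u v x} → x ∈ˢ X u v → ∃ λ (p : Path u v) → x ∈ pathVars p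
  ∈-X⁻ {u} {v} x∈
    with p , _ , x∈p ← find (∈.∈-concatMap⁻ pathVars {xs = paths u v} (∈-⋃-singletons⁻ _ x∈))
    = p , x∈p

  ∣X∣-mono : ∀ {u v w} → Path v w → ∣ X u v ∣ ≤ ∣ X u w ∣
  ∣X∣-mono q = Subset.p⊆q⇒∣p∣≤∣q∣ λ x∈ → let p , x∈p = ∈-X⁻ x∈ in
    ∈-X⁺ (p ◅◅ q) (subst (_ ∈_) (sym (pathVars-◅◅ p q)) (∈.∈-++⁺ˡ x∈p))

  ∣Xuu∣≡0 : ∀ u → ∣ X u u ∣ ≡ 0
  ∣Xuu∣≡0 u = ≡.trans (cong ∣_∣ (Subset.Empty-unique empty)) (Subset.∣⊥∣≡0 n)
    where
    empty : Empty (X u u)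
    empty (x , x∈) with ∈-X⁻ x∈
    ... | e ∷ p , _ = contradiction (closedPath-length (e ∷ p)) λ ()

  -- A variable in both sets lies on some path from `s` to `v` and on some path from `v` to `t`;
  -- their concatenation would contain it twice.
  ∣Xsv∣+∣Xvt∣≤n : SyntacticMultilinear → ∀ v → ∣ X s v ∣ + ∣ X v t ∣ ≤ n
  ∣Xsv∣+∣Xvt∣≤n sml v = disjoint⇒∣p∣+∣q∣≤n (X s v) (X v t) λ {x} x∈ x∈′ →
    let p , x∈p = ∈-X⁻ x∈
        q , x∈q = ∈-X⁻ x∈′
    in contradiction
      (ℕ.≤-trans (ℕ.+-mono-≤ (∈-pathVars⇒occurs p x∈p) (∈-pathVars⇒occurs q x∈q))
        (subst (_≤ 1) (occurrences-◅◅ x p q) (sml (p ◅◅ q) x)))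
      λ { (s≤s ()) }

  -- The low vertices and the bound for edges of the second kind.

  s≢t : s ≢ t
  s≢t s≡t = ℕ.<⇒≢ 0<last $ ≡.trans
    (cong toℕ (≡.trans (sym (Equivalence.from (layer-s s) refl)) (Equivalence.from (layer-t s) s≡t)))
    (Fin.toℕ-fromℕ lastLayer)

  path-from-t : ∀ {v} → Path t v → v ≡ t
  path-from-t []      = refl
  path-from-t (e ∷ _) = contradiction e (Equivalence.from (outdegree0 t) refl _)

  -- Excluding `t` explicitly guarantees a cut even when `X s t` itself has at most two thirds of
  -- the variables.
  Low : Fin S → Set
  Low u = u ≢ t × 3 * ∣ X s u ∣ ≤ 2 * n

  low? : Decidable Low
  low? u = ¬? (u Fin.≟ t) ×-dec (3 * ∣ X s u ∣ ℕ.≤? 2 * n)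

  low-down : ∀ {u v} → Path u v → Low v → Low u
  low-down p (v≢t , small) =
    (λ { refl → v≢t (path-from-t p) }) ,
    ℕ.≤-trans (ℕ.*-monoʳ-≤ 3 (∣X∣-mono p)) small

  low-s : Low s
  low-s = s≢t , subst (λ k → 3 * k ≤ 2 * n) (sym (∣Xuu∣≡0 s)) z≤n

  open Cut Low low? low-down low-s (λ low-t → proj₁ low-t refl)

  crossing-small : SyntacticMultilinear → ∀ {e} → Crossing e → 3 * ∣ X s (tail e) ∣ ≤ n →
                   3 * (∣ X s (tail e) ∣ + ∣ X (head e) t ∣) ≤ 2 * n
  crossing-small sml {edge u v _} ((_ , 3A≤2n) , ¬low-v) 3A≤n with v Fin.≟ t
  -- Here the second set is empty, and lowness of `u` alone gives the bound.
  ... | yes refl = subst (λ k → 3 * k ≤ 2 * n)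
    (sym (≡.trans (cong (∣ X s u ∣ +_) (∣Xuu∣≡0 t)) (ℕ.+-identityʳ ∣ X s u ∣))) 3A≤2n
  ... | no v≢t = begin
    3 * (∣ X s u ∣ + ∣ X v t ∣)     ≡⟨ ℕ.*-distribˡ-+ 3 ∣ X s u ∣ ∣ X v t ∣ ⟩
    3 * ∣ X s u ∣ + 3 * ∣ X v t ∣   ≤⟨ ℕ.+-mono-≤ 3A≤n 3B≤n ⟩
    n + n                           ≡⟨ cong (n +_) (ℕ.+-identityʳ n) ⟨
    2 * n                           ∎
    where
    open ℕ.≤-Reasoning
    3B≤n : 3 * ∣ X v t ∣ ≤ n
    -- As `v` differs from `t`, it can fail to be low only by the size of `X s v`, so `2 * n` is a
    -- lower bound for `3 * ∣ X s v ∣` and can be cancelled from the disjointness bound.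
    3B≤n = ℕ.+-cancelˡ-≤ (2 * n) _ _ $ begin
      2 * n + 3 * ∣ X v t ∣         ≤⟨ ℕ.+-monoˡ-≤ _ (ℕ.≰⇒≥ (λ 3A′≤2n → ¬low-v (v≢t , 3A′≤2n))) ⟩
      3 * ∣ X s v ∣ + 3 * ∣ X v t ∣ ≡⟨ ℕ.*-distribˡ-+ 3 ∣ X s v ∣ ∣ X v t ∣ ⟨
      3 * (∣ X s v ∣ + ∣ X v t ∣)   ≤⟨ ℕ.*-monoʳ-≤ 3 (∣Xsv∣+∣Xvt∣≤n sml v) ⟩
      -- `3 * n` unfolds to `n + 2 * n`.
      3 * n                         ≡⟨ ℕ.+-comm n (2 * n) ⟩
      2 * n + n                     ∎

  -- Sorting the cut edges into the two kinds.

  decomposition : SyntacticMultilinear → (f : Polynomial) → Computes f →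
    Σ[ uvs ∈ List Edge ] Σ[ was ∈ List Edge ]
      (Unique uvs × Unique was ×
       All (λ e → (n ≤ 3 * ∣ X s (tail e) ∣) × (3 * ∣ X s (tail e) ∣ ≤ 2 * n)) uvs ×
       All (λ e → 3 * (∣ X s (tail e) ∣ + ∣ X (head e) t ∣) ≤ 2 * n) was ×
       (f ≈ₚ (∑through uvs +ₚ ∑through was)))
  decomposition sml f f≈[s,t] =
    uvs , was , uvs! , was! ,
    All.map (λ (((_ , small) , _) , big) → big , small) (All.all-filter uv? allEdges) ,
    All.map (λ {e} (cr , ¬big) → crossing-small sml {e} cr (ℕ.≰⇒≥ ¬big)) (All.all-filter wa? allEdges) ,
    -- Since `_+ₚ_` is `_++_`, `∑through` is a `concatMap` and splits propositionally along
    -- `uvs ++ was`.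
    λ m → F.trans (f≈[s,t] m) (subst (λ p → coeff [ s , t ] m F.≈ coeff p m)
      (List.concatMap-++ through uvs was) ([s,t]≈∑through uvs++was! sound complete m))
    where
    Big : Edge → Set
    Big e = n ≤ 3 * ∣ X s (tail e) ∣

    big? : Decidable Big
    big? e = n ℕ.≤? 3 * ∣ X s (tail e) ∣

    uv? : Decidable (λ e → Crossing e × Big e)
    uv? e = crossing? e ×-dec big? e

    wa? : Decidable (λ e → Crossing e × ¬ Big e)
    wa? e = crossing? e ×-dec ¬? (big? e)

    uvs = filter uv? allEdges
    was = filter wa? allEdges

    uvs! = Unique.filter⁺ uv? allEdges-unique
    was! = Unique.filter⁺ wa? allEdges-unique

    uvs++was! : Unique (uvs ++ was)
    uvs++was! = Unique.++⁺ uvs! was! λ (e∈ , e∈′) →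
      proj₂ (proj₂ (∈.∈-filter⁻ wa? {xs = allEdges} e∈′))
            (proj₂ (proj₂ (∈.∈-filter⁻ uv? {xs = allEdges} e∈)))

    sound : ∀ {e} → e ∈ uvs ++ was → Crossing e
    sound e∈ with ∈.∈-++⁻ uvs e∈
    ... | inj₁ e∈uvs = proj₁ (proj₂ (∈.∈-filter⁻ uv? {xs = allEdges} e∈uvs))
    ... | inj₂ e∈was = proj₁ (proj₂ (∈.∈-filter⁻ wa? {xs = allEdges} e∈was))

    complete : ∀ {e} → Crossing e → e ∈ uvs ++ was
    complete {e} cr with big? e
    ... | yes big = ∈.∈-++⁺ˡ (∈.∈-filter⁺ uv? (∈-allEdges e) (cr , big))
    ... | no ¬big = ∈.∈-++⁺ʳ uvs (∈.∈-filter⁺ wa? (∈-allEdges e) (cr , ¬big))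

theorem1 : ∀ {c ℓ₁ ℓ₂} (F : HeytingField c ℓ₁ ℓ₂) (n S : ℕ) (P : ABP F n S) →
    let open Polynomials F n
        open Program F n P
    in
    SyntacticMultilinear →
    (f : Polynomial) → Computes f →
    Σ[ uvs ∈ List Edge ] Σ[ was ∈ List Edge ]
      (Unique uvs × Unique was ×
       All (λ e → (n ≤ 3 * ∣ X s (tail e) ∣) × (3 * ∣ X s (tail e) ∣ ≤ 2 * n)) uvs ×
       All (λ e → 3 * (∣ X s (tail e) ∣ + ∣ X (head e) t ∣) ≤ 2 * n) was ×
       (f ≈ₚ (∑through uvs +ₚ ∑through was)))
theorem1 F n S P = decomposition F n P
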